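{- There exists an $\mathcal{O}(n)$ time algorithm that, using $\log n$ bits, generates in-place of the inverse $\pi^-$ of $\pi\in IP(n)$, where $\varphi^-$ is defined implicitly, the multiset $m\in M(n)$ associated with $\pi$ (as a linearly ordered sequence).
   Context: $[n]=\{1,\ldots,n\}$. $M(n)$ is the set of all multisets of $n$ elements selected with replacement from $[n]$; every multiset is regarded as linearly ordered, i.e. as a nondecreasing sequence $m(1),\ldots,m(n)$. An idempotent permutation of degree $k$ ($1\le k\le n$) is a permutation $\pi$ of $[n]$ together with a distinguished set of indices $A=\{a_1<\cdots<a_k\}\subseteq[n]$ such that the values $c_i=\pi(a_i)$ satisfy $1=c_1<c_2<\cdots<c_k$; put $c_{k+1}=n+1$ and $c'_i=c_{i+1}-c_i$. $IP(n)$ denotes the set of idempotent permutations of all degrees $1\le k\le n$. The multiset associated with $\pi$ is $m=\{c'_1\cdot a_1,\ldots,c'_k\cdot a_k\}$, where $c'_i$ is the multiplicity of $a_i$; as a sequence, $m(j)=a_i$ for $c_i\le j<c_{i+1}$. $\pi^-$ is the inverse permutation. Its characteristic function $\varphi^-(x)=1$ if $x\in\{c_1,\ldots,c_k\}$ and $0$ otherwise is "defined implicitly" when $\pi^-$ is stored in an array $D[1\ldots n]$ with $D_{c_i}=-a_i$ and $D_x=\pi^-(x)$ for all other $x$. "In-place" means that at termination the same array holds $m$. Computation is on a unit-cost random access machine; "$\log n$ bits" means that besides the array one auxiliary variable of $\log n$ bits (an index or value of magnitude $O(n)$) is used. -}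

module Defs where

open import Data.Bool using (Bool; true; false; if_then_else_)
open import Data.Fin as Fin using (Fin; zero; suc; toℕ; fromℕ<; inject₁)
import Data.Fin.Properties as Fin
open import Data.Fin.Permutation using (Permutation′; _⟨$⟩ʳ_; _⟨$⟩ˡ_)
open import Data.Integer as ℤ using (ℤ; +_; -[1+_]; ∣_∣)
import Data.Integer.Properties as ℤ
open import Data.List as List using (List; []; _∷_)
open import Data.List.Relation.Binary.Permutation.Propositional using (_↭_)
open import Data.Maybe using (Maybe; just; nothing; _>>=_)
open import Data.Nat as ℕ using (ℕ; zero; suc; _*_; _∸_; _≤_; _<_)
import Data.Nat.Properties as ℕ
open import Data.Product using (∃)
open import Data.Vec as Vec using (Vec; lookup; toList; _[_]≔_)
open import Data.Vec.Relation.Unary.All using (All)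
open import Relation.Binary.PropositionalEquality using (_≡_)
open import Relation.Nullary using (does; yes; no)

-- Fin n plays the role of [n] = {1,…,n}; the number denoted by x is ⟦ x ⟧.
⟦_⟧ : ∀ {n} → Fin n → ℕ
⟦ x ⟧ = suc (toℕ x)

------------------------------------------------------------------------
-- M(n) and IP(n)

record M (n : ℕ) : Set where
  field
    seq           : Vec (Fin n) n
    nondecreasing : ∀ {i j} → i Fin.≤ j → lookup seq i Fin.≤ lookup seq j

record IdempotentPermutation (n k : ℕ) : Set where
  field
    1≤k : 1 ≤ k
    k≤n : k ≤ n
    π   : Permutation′ n
    -- The distinguished set A, given by its increasing enumeration.
    a   : Fin k → Fin n

  c : Fin k → Fin n
  c i = π ⟨$⟩ʳ a i

  field
    a-increasing : ∀ {i j} → i Fin.< j → a i Fin.< a j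
    c-increasing : ∀ {i j} → i Fin.< j → c i Fin.< c j
    c₁≡1         : ⟦ c (fromℕ< 1≤k) ⟧ ≡ 1

  π⁻ : Fin n → Fin n
  π⁻ x = π ⟨$⟩ˡ x

  φ⁻ : Fin n → Bool
  φ⁻ x = does (Fin.any? (λ i → x Fin.≟ c i))

IP : ℕ → Set
IP n = ∃ (IdempotentPermutation n)

-- Appends a last value to a finite sequence.
_▹_ : ∀ {k} {A : Set} → (Fin k → A) → A → Fin (suc k) → A
_▹_ {zero}  f z _       = z
_▹_ {suc k} f z zero    = f zero
_▹_ {suc k} f z (suc i) = ((λ j → f (suc j)) ▹ z) i

module _ {n k : ℕ} (p : IdempotentPermutation n k) where
  open IdempotentPermutation p

  -- c₁,…,cₖ,cₖ₊₁ with cₖ₊₁ = n+1.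
  c⁺ : Fin (suc k) → ℕ
  c⁺ = (λ i → ⟦ c i ⟧) ▹ suc n

  c′ : Fin k → ℕ
  c′ i = c⁺ (suc i) ∸ c⁺ (inject₁ i)

  -- The multiset {c′₁·a₁,…,c′ₖ·aₖ}: lists are read up to permutation.
  weighted : List (Fin n)
  weighted = List.concatMap (λ i → List.replicate (c′ i) (a i)) (List.allFin k)

  record Associated (m : M n) : Set where
    open M m
    field
      multiset : toList seq ↭ weighted
      sequence : ∀ i j → c⁺ (inject₁ i) ≤ ⟦ j ⟧ → ⟦ j ⟧ < c⁺ (suc i) →
                 lookup seq j ≡ a i

  -- The array D holds π⁻, the minus signs marking the places where φ⁻ = 1.
  record ImplicitInverse (D : Vec ℤ n) : Set where
    field
      marked   : ∀ i → lookup D (c i) ≡ ℤ.- (+ ⟦ a i ⟧)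
      unmarked : ∀ x → φ⁻ x ≡ false → lookup D x ≡ + ⟦ π⁻ x ⟧

-- The array contents m(1),…,m(n).
contents : ∀ {n} → M n → Vec ℤ n
contents m = Vec.map (λ x → + ⟦ x ⟧) (M.seq m)

------------------------------------------------------------------------
-- Unit-cost random access machine with an array D[1…n] and r auxiliary
-- variables.  Apart from these, a program can only consult the array
-- length n, which it cannot overwrite, and its own constants.

data Location (r : ℕ) : Set where
  var  : Fin r → Location r
  cell : Fin r → ℤ → Location r    -- cell x d is D[x + d]

data Operand (r : ℕ) : Set where
  const : ℤ → Operand r
  size  : Operand r
  ref   : Location r → Operand r

data Instruction (r : ℕ) : Set where
  _≔_        : Location r → Operand r → Instruction r
  _≔_⊕_      : Location r → Operand r → Operand r → Instruction r
  _≔_⊖_      : Location r → Operand r → Operand r → Instruction r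
  jump       : ℕ → Instruction r
  if_<_jump_ : Operand r → Operand r → ℕ → Instruction r
  halt       : Instruction r

-- A program does not depend on n; jump targets count instructions from 0.
Program : ℕ → Set
Program r = List (Instruction r)

fetch : ∀ {r} → Program r → ℕ → Maybe (Instruction r)
fetch P l = List.head (List.drop l P)

record Config (r n : ℕ) : Set where
  constructor config
  field
    pc    : ℕ
    vars  : Vec ℤ r
    array : Vec ℤ n

open Config public

-- The cell with a given 1-based address; other addresses are errors.
address : ∀ n → ℤ → Maybe (Fin n)
address n (+ suc j) with j ℕ.<? n
... | yes j<n = just (fromℕ< j<n)
... | no  _   = nothing
address n (+ zero)  = nothing
address n -[1+ _ ]  = nothing

module _ {r n : ℕ} where

  eval : Config r n → Operand r → Maybe ℤ
  eval s (const z)        = just z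
  eval s size             = just (+ n)
  eval s (ref (var x))    = just (lookup (vars s) x)
  eval s (ref (cell x d)) = do
    j ← address n (lookup (vars s) x ℤ.+ d)
    just (lookup (array s) j)

  -- Stores a value and proceeds to the next instruction.
  store : Config r n → Location r → ℤ → Maybe (Config r n)
  store (config l vs D) (var x)    v = just (config (suc l) (vs [ x ]≔ v) D)
  store (config l vs D) (cell x d) v = do
    j ← address n (lookup vs x ℤ.+ d)
    just (config (suc l) vs (D [ j ]≔ v))

  goto : ℕ → Config r n → Config r n
  goto l s = record s { pc = l }

  execute : Instruction r → Config r n → Maybe (Config r n)
  execute (t ≔ e)      s = eval s e >>= store s t
  execute (t ≔ e ⊕ e′) s = do
    v ← eval s e
    w ← eval s e′
    store s t (v ℤ.+ w)
  execute (t ≔ e ⊖ e′) s = do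
    v ← eval s e
    w ← eval s e′
    store s t (v ℤ.- w)
  execute (jump l)     s = just (goto l s)
  execute (if e < e′ jump l) s = do
    v ← eval s e
    w ← eval s e′
    just (goto (if does (v ℤ.<? w) then l else suc (pc s)) s)
  execute halt         s = nothing

  step : Program r → Config r n → Maybe (Config r n)
  step P s = do
    i ← fetch P (pc s)
    execute i s

  -- Variables have magnitude at most S·n, i.e. log n + O(1) bits.  Array cells
  -- have room only for a signed element of [n], as in the input, so that the
  -- array offers no further storage.
  record Fits (S : ℕ) (s : Config r n) : Set where
    field
      vars-fit  : All (λ v → ∣ v ∣ ≤ S * n) (vars s)
      array-fit : All (λ v → ∣ v ∣ ≤ n) (array s)

  -- Run P S s t s′: started in s, program P halts in s′ after t steps, each of
  -- the configurations passed, s and s′ included, fitting in the space.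
  data Run (P : Program r) (S : ℕ) : Config r n → ℕ → Config r n → Set where
    halted : ∀ {s} → Fits S s → fetch P (pc s) ≡ just halt → Run P S s 0 s
    next   : ∀ {s s′ s″ t} → Fits S s → step P s ≡ just s′ → Run P S s′ t s″ →
             Run P S s (suc t) s″

initial : ∀ {r n} → Vec ℤ n → Config r n
initial D = config 0 (Vec.replicate _ (+ 0)) D

{-# OPTIONS --safe #-}
module Submission where

-- The sequence m is constant between two consecutive marked places, and takes
-- the value a i at the place c i.  Since D holds - a i at c i and only
-- positive numbers elsewhere, one sweep of the index v from left to right
-- suffices: a negative entry is negated, and a positive one is overwritten by
-- the entry to its left, which by then is an entry of m.  The first place is
-- marked because c₁ = 1, so an entry to the left is there whenever it is
-- needed.  The index is the only auxiliary variable, it never exceeds n, and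
-- each place costs at most 5 steps.
--
-- To define m, owner c x is the number of the last c i that is at most x;
-- then m(j) = a (owner c j).  By owner-≡ this agrees with the description of
-- m by intervals, owner-suc is the copying step of the sweep, and segments
-- turns the interval description into equality with the weighted list.
-- Progress is the loop invariant, body one round of the loop and sweep the
-- whole computation.

open import Defs
open import Data.Fin as Fin using (Fin; zero; suc; toℕ; inject₁; fromℕ)
import Data.Fin.Properties as Fin
open import Data.Integer as ℤ using (ℤ; +_; -[1+_]; ∣_∣)
import Data.Integer.Properties as ℤ
open import Data.List as List using (List; []; _∷_; _++_; replicate; applyUpTo; concat)
import Data.List.Properties as List
open import Data.List.Relation.Binary.Permutation.Propositional using (↭-reflexive)
open import Data.Maybe using (just)
open import Data.Nat as ℕ using (ℕ; zero; suc; _*_; _∸_; _≤_; _<_; z≤n; s≤s)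
import Data.Nat.Properties as ℕ
open import Data.Product using (Σ-syntax; _×_; _,_; proj₁; proj₂)
open import Data.Sum using (inj₁; inj₂)
open import Data.Vec as Vec using (Vec; []; _∷_; lookup; tabulate; toList; _[_]≔_)
import Data.Vec.Properties as Vec
open import Data.Vec.Relation.Unary.All using ([]; _∷_)
import Data.Vec.Relation.Unary.All.Properties as All
open import Function using (_∘_)
open import Relation.Binary.PropositionalEquality
  using (_≡_; _≢_; refl; sym; trans; cong; cong₂; subst; module ≡-Reasoning)
open import Relation.Nullary using (yes; no; contradiction)
open import Relation.Nullary.Decidable using (dec-true; dec-false)

-- Locating a number among increasing breakpoints

-- The largest i with f i ≤ x, for increasing f.  The value f zero is never
-- inspected: numbers below it are assigned to zero as well.
owner : ∀ {k} → (Fin (suc k) → ℕ) → ℕ → Fin (suc k)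
owner {zero}  f x = zero
owner {suc k} f x with f (suc zero) ℕ.≤? x
... | yes _ = suc (owner (f ∘ suc) x)
... | no  _ = zero

owner-mono : ∀ {k} (f : Fin (suc k) → ℕ) {x y} → x ≤ y → owner f x Fin.≤ owner f y
owner-mono {zero}  f x≤y = z≤n
owner-mono {suc k} f {x} {y} x≤y with f (suc zero) ℕ.≤? x | f (suc zero) ℕ.≤? y
... | yes _   | yes _   = s≤s (owner-mono (f ∘ suc) x≤y)
... | yes f≤x | no  f≰y = contradiction (ℕ.≤-trans f≤x x≤y) f≰y
... | no  _   | _       = z≤n

owner-suc : ∀ {k} (f : Fin (suc k) → ℕ) {x} → (∀ i → f i ≢ suc x) →
            owner f (suc x) ≡ owner f x
owner-suc {zero}  f f≢ = refl
owner-suc {suc k} f {x} f≢ with f (suc zero) ℕ.≤? suc x | f (suc zero) ℕ.≤? x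
... | yes _    | yes _   = cong suc (owner-suc (f ∘ suc) (f≢ ∘ suc))
... | yes f≤sx | no  f≰x = contradiction (ℕ.≤-antisym f≤sx (ℕ.≰⇒> f≰x)) (f≢ (suc zero))
... | no  f≰sx | yes f≤x = contradiction (ℕ.m≤n⇒m≤1+n f≤x) f≰sx
... | no  _    | no  _   = refl

▹-inject₁ : ∀ {k} {A : Set} (f : Fin k → A) z i → (f ▹ z) (inject₁ i) ≡ f i
▹-inject₁ f z zero    = refl
▹-inject₁ f z (suc i) = ▹-inject₁ (f ∘ suc) z i

▹-fromℕ : ∀ {k} {A : Set} (f : Fin k → A) z → (f ▹ z) (fromℕ k) ≡ z
▹-fromℕ {zero}  f z = refl
▹-fromℕ {suc k} f z = ▹-fromℕ (f ∘ suc) z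

StrictlyIncreasing : ∀ {k} → (Fin k → ℕ) → Set
StrictlyIncreasing f = ∀ {i j} → i Fin.< j → f i < f j

▹-gap : ∀ {k} {f : Fin k → ℕ} {z} → StrictlyIncreasing f → (∀ i → f i < z) →
        ∀ i → (f ▹ z) (inject₁ i) < (f ▹ z) (suc i)
▹-gap {suc zero}    f↑ f<z zero    = f<z zero
▹-gap {suc (suc k)} f↑ f<z zero    = f↑ (s≤s z≤n)
▹-gap {suc k}       f↑ f<z (suc i) = ▹-gap (f↑ ∘ s≤s) (f<z ∘ suc) i

owner-≡ : ∀ {k} {f : Fin (suc k) → ℕ} {z} → StrictlyIncreasing f → ∀ i {x} →
          (f ▹ z) (inject₁ i) ≤ x → x < (f ▹ z) (suc i) → owner f x ≡ i
owner-≡ {zero}  f↑ zero f≤x x<f = refl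
owner-≡ {suc k} {f} f↑ zero {x} f≤x x<f with f (suc zero) ℕ.≤? x
... | yes f₁≤x = contradiction x<f (ℕ.≤⇒≯ f₁≤x)
... | no  _    = refl
owner-≡ {suc k} {f} {z} f↑ (suc i) {x} f≤x x<f with f (suc zero) ℕ.≤? x
... | yes _    = cong suc (owner-≡ {z = z} (f↑ ∘ s≤s) i f≤x x<f)
... | no  f₁≰x = contradiction (ℕ.≤-trans (first i) f≤x) f₁≰x
  where
  first : ∀ i → f (suc zero) ≤ (f ▹ z) (inject₁ (suc i))
  first zero    = ℕ.≤-refl
  first (suc i) = ℕ.≤-trans (ℕ.<⇒≤ (f↑ (s≤s (s≤s z≤n))))
                            (ℕ.≤-reflexive (sym (▹-inject₁ f z (suc (suc i)))))

-- Piecewise constant sequences as weighted lists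

applyUpTo-+ : ∀ {A : Set} (g : ℕ → A) k l →
              applyUpTo g (k ℕ.+ l) ≡ applyUpTo g k ++ applyUpTo (g ∘ (k ℕ.+_)) l
applyUpTo-+ g zero    l = refl
applyUpTo-+ g (suc k) l = cong (g 0 ∷_) (applyUpTo-+ (g ∘ suc) k l)

applyUpTo-cong : ∀ {A : Set} {g h : ℕ → A} l → (∀ x → g x ≡ h x) →
                 applyUpTo g l ≡ applyUpTo h l
applyUpTo-cong zero    g≗h = refl
applyUpTo-cong (suc l) g≗h = cong₂ _∷_ (g≗h 0) (applyUpTo-cong l (g≗h ∘ suc))

applyUpTo-constant : ∀ {A : Set} {g : ℕ → A} {b} l → (∀ {x} → x < l → g x ≡ b) →
                     applyUpTo g l ≡ replicate l b
applyUpTo-constant zero    g≡b = refl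
applyUpTo-constant (suc l) g≡b =
  cong₂ _∷_ (g≡b (s≤s z≤n)) (applyUpTo-constant l (g≡b ∘ s≤s))

head≤last : ∀ k {f : Fin (suc k) → ℕ} → (∀ i → f (inject₁ i) ≤ f (suc i)) →
            f zero ≤ f (fromℕ k)
head≤last zero    f↑ = ℕ.≤-refl
head≤last (suc k) {f} f↑ = ℕ.≤-trans (f↑ zero) (head≤last k {f ∘ suc} (f↑ ∘ suc))

∸-split : ∀ {x y z} → x ≤ y → y ≤ z → z ∸ x ≡ (y ∸ x) ℕ.+ (z ∸ y)
∸-split {x} {y} {z} x≤y y≤z = begin
  z ∸ x              ≡⟨ cong (_∸ x) (ℕ.m+[n∸m]≡n y≤z) ⟨
  y ℕ.+ (z ∸ y) ∸ x    ≡⟨ ℕ.+-∸-comm (z ∸ y) x≤y ⟩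
  (y ∸ x) ℕ.+ (z ∸ y)  ∎
  where open ≡-Reasoning

-- If g takes the value b i on the interval from f (inject₁ i) to f (suc i),
-- right end excluded, then its values from f zero to the last f, in order,
-- form the list of the b i, each repeated as often as its interval is long.
segments : ∀ k {A : Set} (f : Fin (suc k) → ℕ) (b : Fin k → A) (g : ℕ → A) →
           (∀ i → f (inject₁ i) ≤ f (suc i)) →
           (∀ i x → f (inject₁ i) ≤ x → x < f (suc i) → g x ≡ b i) →
           applyUpTo (g ∘ (f zero ℕ.+_)) (f (fromℕ k) ∸ f zero) ≡
           concat (List.tabulate (λ i → replicate (f (suc i) ∸ f (inject₁ i)) (b i)))
segments zero    f b g f↑ g≡b rewrite ℕ.n∸n≡0 (f zero) = refl
segments (suc k) f b g f↑ g≡b = begin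
  applyUpTo (g ∘ (f₀ ℕ.+_)) (fₖ ∸ f₀)
    ≡⟨ cong (applyUpTo _) (∸-split (f↑ zero) (head≤last k {f ∘ suc} (f↑ ∘ suc))) ⟩
  applyUpTo (g ∘ (f₀ ℕ.+_)) ((f₁ ∸ f₀) ℕ.+ (fₖ ∸ f₁))
    ≡⟨ applyUpTo-+ _ (f₁ ∸ f₀) (fₖ ∸ f₁) ⟩
  applyUpTo (g ∘ (f₀ ℕ.+_)) (f₁ ∸ f₀) ++
  applyUpTo (λ x → g (f₀ ℕ.+ ((f₁ ∸ f₀) ℕ.+ x))) (fₖ ∸ f₁)
    ≡⟨ cong₂ _++_ (applyUpTo-constant (f₁ ∸ f₀) first) (applyUpTo-cong (fₖ ∸ f₁) shift) ⟩
  replicate (f₁ ∸ f₀) (b zero) ++ applyUpTo (g ∘ (f₁ ℕ.+_)) (fₖ ∸ f₁)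
    ≡⟨ cong (replicate (f₁ ∸ f₀) (b zero) ++_)
            (segments k (f ∘ suc) (b ∘ suc) g (f↑ ∘ suc) (g≡b ∘ suc)) ⟩
  concat (List.tabulate (λ i → replicate (f (suc i) ∸ f (inject₁ i)) (b i))) ∎
  where
  open ≡-Reasoning
  f₀ = f zero
  f₁ = f (suc zero)
  fₖ = f (fromℕ (suc k))

  first : ∀ {x} → x < f₁ ∸ f₀ → g (f₀ ℕ.+ x) ≡ b zero
  first {x} x<l = g≡b zero (f₀ ℕ.+ x) (ℕ.m≤m+n f₀ x)
    (subst (f₀ ℕ.+ x <_) (ℕ.m+[n∸m]≡n (f↑ zero)) (ℕ.+-monoʳ-< f₀ x<l))

  shift : ∀ x → g (f₀ ℕ.+ ((f₁ ∸ f₀) ℕ.+ x)) ≡ g (f₁ ℕ.+ x)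
  shift x = cong g (trans (sym (ℕ.+-assoc f₀ _ x)) (cong (ℕ._+ x) (ℕ.m+[n∸m]≡n (f↑ zero))))

toList-tabulate : ∀ {A : Set} n (g : ℕ → A) →
                  toList (tabulate {n = n} (g ∘ toℕ)) ≡ applyUpTo g n
toList-tabulate zero    g = refl
toList-tabulate (suc n) g = cong (g 0 ∷_) (toList-tabulate n (g ∘ suc))

lookup-ext : ∀ {A : Set} {n} {xs ys : Vec A n} →
             (∀ i → lookup xs i ≡ lookup ys i) → xs ≡ ys
lookup-ext {xs = xs} {ys} eq = begin
  xs                    ≡⟨ Vec.tabulate∘lookup xs ⟨
  tabulate (lookup xs)  ≡⟨ Vec.tabulate-cong eq ⟩
  tabulate (lookup ys)  ≡⟨ Vec.tabulate∘lookup ys ⟩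
  ys                    ∎
  where open ≡-Reasoning

-- The multiset of an idempotent permutation

module Multiset {n k} (p : IdempotentPermutation n (suc k)) where
  open IdempotentPermutation p

  -- The marked places c₁,…,cₖ as numbers.
  places : Fin (suc k) → ℕ
  places i = ⟦ c i ⟧

  places-increasing : StrictlyIncreasing places
  places-increasing i<j = s≤s (c-increasing i<j)

  c⁺-gap : ∀ i → c⁺ p (inject₁ i) < c⁺ p (suc i)
  c⁺-gap = ▹-gap places-increasing (λ i → s≤s (Fin.toℕ<n (c i)))

  -- The value m(x); x is the number itself, not the element of Fin n.
  value : ℕ → Fin n
  value x = a (owner places x)

  value-interval : ∀ i x → c⁺ p (inject₁ i) ≤ x → x < c⁺ p (suc i) → value x ≡ a i
  value-interval i x c≤x x<c = cong a (owner-≡ {z = suc n} places-increasing i c≤x x<c)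

  value-marked : ∀ i → value ⟦ c i ⟧ ≡ a i
  value-marked i = value-interval i ⟦ c i ⟧ (ℕ.≤-reflexive eq) (subst (_< c⁺ p (suc i)) eq (c⁺-gap i))
    where
    eq : c⁺ p (inject₁ i) ≡ ⟦ c i ⟧
    eq = ▹-inject₁ places (suc n) i

  -- At a place without a mark, m repeats the value before it.
  value-unmarked : ∀ (x : Fin n) → (∀ i → x ≢ c i) → value ⟦ x ⟧ ≡ value (toℕ x)
  value-unmarked x x≢c =
    cong a (owner-suc places (λ i eq → x≢c i (sym (Fin.toℕ-injective (ℕ.suc-injective eq)))))

  a-mono : ∀ {i j} → i Fin.≤ j → a i Fin.≤ a j
  a-mono i≤j with ℕ.m≤n⇒m<n∨m≡n i≤j
  ... | inj₁ i<j = ℕ.<⇒≤ (a-increasing i<j)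
  ... | inj₂ i≡j = ℕ.≤-reflexive (cong (toℕ ∘ a) (Fin.toℕ-injective i≡j))

  sequence : Vec (Fin n) n
  sequence = tabulate (λ x → value ⟦ x ⟧)

  lookup-sequence : ∀ x → lookup sequence x ≡ value ⟦ x ⟧
  lookup-sequence = Vec.lookup∘tabulate (λ x → value ⟦ x ⟧)

  m : M n
  m = record
    { seq           = sequence
    ; nondecreasing = λ {i} {j} i≤j →
        subst (Fin._≤ lookup sequence j) (sym (lookup-sequence i))
          (subst (value ⟦ i ⟧ Fin.≤_) (sym (lookup-sequence j))
            (a-mono (owner-mono places (s≤s i≤j))))
    }

  toList-sequence : toList sequence ≡ weighted p
  toList-sequence = begin
    toList sequence
      ≡⟨ toList-tabulate n (value ∘ suc) ⟩
    applyUpTo (value ∘ (1 ℕ.+_)) (suc n ∸ 1)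
      -- The intervals start at c₁ = 1 and end at n + 1.
      ≡⟨ cong₂ (λ s e → applyUpTo (value ∘ (s ℕ.+_)) (e ∸ s))
               (sym first) (sym (▹-fromℕ places (suc n))) ⟩
    applyUpTo (value ∘ (c⁺ p zero ℕ.+_)) (c⁺ p (fromℕ (suc k)) ∸ c⁺ p zero)
      ≡⟨ segments (suc k) (c⁺ p) a value (ℕ.<⇒≤ ∘ c⁺-gap) value-interval ⟩
    concat (List.tabulate (λ i → replicate (c′ p i) (a i)))
      ≡⟨ cong concat (List.map-tabulate (λ i → i) (λ i → replicate (c′ p i) (a i))) ⟨
    weighted p ∎
    where
    open ≡-Reasoning
    first : ⟦ c zero ⟧ ≡ 1
    first = c₁≡1

  m-associated : Associated p m
  m-associated = record
    { multiset = ↭-reflexive toList-sequence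
    ; sequence = λ i j c≤j j<c → trans (lookup-sequence j) (value-interval i ⟦ j ⟧ c≤j j<c)
    }

-- The program and its run

-- The index v runs from 0, its initial content, up to n; the current place is
-- D[v+1] and its left neighbour D[v].  So the index at the place x : Fin n is
-- toℕ x.  Instructions 0 to 3 decode the current place, 4 and 5 move on; the
-- loop is tested at its end because n is at least 1.
program : Program 1
program =
  (if ref (cell zero (+ 1)) < const (+ 0) jump 3) ∷
  (cell zero (+ 1) ≔ ref (cell zero (+ 0))) ∷
  jump 4 ∷
  (cell zero (+ 1) ≔ const (+ 0) ⊖ ref (cell zero (+ 1))) ∷
  (var zero ≔ ref (var zero) ⊕ const (+ 1)) ∷
  (if ref (var zero) < size jump 0) ∷
  halt ∷ []

address-⟦⟧ : ∀ {n} (x : Fin n) {z} → z ≡ + ⟦ x ⟧ → address n z ≡ just x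
address-⟦⟧ {n} x refl with toℕ x ℕ.<? n
... | yes x<n = cong just (Fin.fromℕ<-toℕ x x<n)
... | no  x≮n = contradiction (Fin.toℕ<n x) x≮n

address-current : ∀ {n} (x : Fin n) → address n (+ toℕ x ℤ.+ + 1) ≡ just x
address-current x = address-⟦⟧ x (cong +_ (ℕ.+-comm (toℕ x) 1))

address-left : ∀ {n} (x y : Fin n) → ⟦ y ⟧ ≡ toℕ x → address n (+ toℕ x ℤ.+ + 0) ≡ just y
address-left x y eq = address-⟦⟧ y (cong +_ (trans (ℕ.+-identityʳ (toℕ x)) (sym eq)))

module Steps {n : ℕ} where

  test-marked : ∀ (x : Fin n) E {v} → lookup E x ≡ -[1+ v ] →
                step program (config 0 (+ toℕ x ∷ []) E) ≡ just (config 3 (+ toℕ x ∷ []) E)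
  test-marked x E entry rewrite address-current x | entry = refl

  test-unmarked : ∀ (x : Fin n) E {v} → lookup E x ≡ + suc v →
                  step program (config 0 (+ toℕ x ∷ []) E) ≡ just (config 1 (+ toℕ x ∷ []) E)
  test-unmarked x E entry rewrite address-current x | entry = refl

  copy : ∀ (x y : Fin n) E → ⟦ y ⟧ ≡ toℕ x →
         step program (config 1 (+ toℕ x ∷ []) E) ≡
         just (config 2 (+ toℕ x ∷ []) (E [ x ]≔ lookup E y))
  copy x y E y-left rewrite address-left x y y-left | address-current x = refl

  negate : ∀ (x : Fin n) E {v} → lookup E x ≡ -[1+ v ] →
           step program (config 3 (+ toℕ x ∷ []) E) ≡
           just (config 4 (+ toℕ x ∷ []) (E [ x ]≔ + suc v))
  negate x E entry rewrite address-current x | entry = refl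

  increment : ∀ j (E : Vec ℤ n) →
              step program (config 4 (+ j ∷ []) E) ≡ just (config 5 (+ suc j ∷ []) E)
  increment j E rewrite ℕ.+-comm j 1 = refl

  continue : ∀ {j} (E : Vec ℤ n) → j < n →
             step program (config 5 (+ j ∷ []) E) ≡ just (config 0 (+ j ∷ []) E)
  continue {j} E j<n rewrite dec-true (+ j ℤ.<? + n) (ℤ.+<+ j<n) = refl

  exit : ∀ (E : Vec ℤ n) →
         step program (config 5 (+ n ∷ []) E) ≡ just (config 6 (+ n ∷ []) E)
  exit E rewrite dec-false (+ n ℤ.<? + n) (ℤ.<-irrefl refl) = refl

left-neighbour : ∀ {n} (x : Fin n) → toℕ x ≢ 0 → Σ[ y ∈ Fin n ] ⟦ y ⟧ ≡ toℕ x
left-neighbour zero    x≢0 = contradiction refl x≢0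
left-neighbour (suc x) _   = inject₁ x , cong suc (Fin.toℕ-inject₁ x)

module Sweep {n k} (p : IdempotentPermutation n (suc k))
             (D : Vec ℤ n) (D-inverse : ImplicitInverse p D) where
  open IdempotentPermutation p
  open ImplicitInverse D-inverse
  open Multiset p
  open Steps

  -- The loop invariant: the first j entries of E are those of m, and the
  -- others are still those of D.
  record Progress (j : ℕ) (E : Vec ℤ n) : Set where
    field
      decoded : ∀ x → toℕ x < j → lookup E x ≡ + ⟦ value ⟦ x ⟧ ⟧
      pending : ∀ x → j ≤ toℕ x → lookup E x ≡ lookup D x

  open Progress

  start : Progress 0 D
  start = record { decoded = λ _ () ; pending = λ _ _ → refl }

  advance : ∀ {E} x {v} → v ≡ + ⟦ value ⟦ x ⟧ ⟧ →
            Progress (toℕ x) E → Progress (suc (toℕ x)) (E [ x ]≔ v)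
  advance {E} x {v} refl inv = record { decoded = dec ; pending = pen }
    where
    dec : ∀ y → toℕ y < suc (toℕ x) → lookup (E [ x ]≔ v) y ≡ + ⟦ value ⟦ y ⟧ ⟧
    dec y y≤x with y Fin.≟ x
    ... | yes refl = Vec.lookup∘update x E v
    ... | no  y≢x  = trans (Vec.lookup∘update′ y≢x E v)
      (decoded inv y (ℕ.≤∧≢⇒< (ℕ.≤-pred y≤x) (y≢x ∘ Fin.toℕ-injective)))

    pen : ∀ y → suc (toℕ x) ≤ toℕ y → lookup (E [ x ]≔ v) y ≡ lookup D y
    pen y x<y = trans (Vec.lookup∘update′ (λ { refl → ℕ.<-irrefl refl x<y }) E v)
      (pending inv y (ℕ.<⇒≤ x<y))

  finished : ∀ {E} → Progress n E → E ≡ contents m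
  finished {E} inv = lookup-ext λ x → begin
    lookup E x                 ≡⟨ decoded inv x (Fin.toℕ<n x) ⟩
    + ⟦ value ⟦ x ⟧ ⟧          ≡⟨ cong (λ y → + ⟦ y ⟧) (lookup-sequence x) ⟨
    + ⟦ lookup sequence x ⟧    ≡⟨ Vec.lookup-map x _ sequence ⟨
    lookup (contents m) x      ∎
    where open ≡-Reasoning

  unmarked-⟦⟧ : ∀ x → (∀ i → x ≢ c i) → lookup D x ≡ + ⟦ π⁻ x ⟧
  unmarked-⟦⟧ x x≢c =
    unmarked x (dec-false (Fin.any? (λ i → x Fin.≟ c i)) (λ (i , x≡c) → x≢c i x≡c))

  -- The entries of D are elements of [n] up to sign; so are those of m, hence
  -- every intermediate array fits.
  D-fits : ∀ x → ∣ lookup D x ∣ ≤ n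
  D-fits x with Fin.any? (λ i → x Fin.≟ c i)
  ... | yes (i , refl) = subst (λ z → ∣ z ∣ ≤ n) (sym (marked i)) (Fin.toℕ<n (a i))
  ... | no  x≢c        = subst (λ z → ∣ z ∣ ≤ n)
    (sym (unmarked-⟦⟧ x (λ i x≡c → x≢c (i , x≡c)))) (Fin.toℕ<n (π⁻ x))

  fits : ∀ {j E l v} → Progress j E → v ≤ n → Fits 1 (config l (+ v ∷ []) E)
  fits {j} {E} inv v≤n = record
    { vars-fit  = ℕ.≤-trans v≤n (ℕ.≤-reflexive (sym (ℕ.*-identityˡ n))) ∷ []
    ; array-fit = All.lookup⁻ entry
    }
    where
    entry : ∀ x → ∣ lookup E x ∣ ≤ n
    entry x with toℕ x ℕ.<? j
    ... | yes x<j = subst (λ z → ∣ z ∣ ≤ n) (sym (decoded inv x x<j)) (Fin.toℕ<n (value ⟦ x ⟧))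
    ... | no  x≮j = subst (λ z → ∣ z ∣ ≤ n) (sym (pending inv x (ℕ.≮⇒≥ x≮j))) (D-fits x)

  c₁-zero : ∀ (x : Fin n) → toℕ x ≡ 0 → x ≡ c zero
  c₁-zero x x≡0 = Fin.toℕ-injective (trans x≡0 (sym (ℕ.suc-injective c₁≡1)))

  -- Decoding the current place takes at most 3 steps.  The last component
  -- prepends these steps to any run that continues from instruction 4.
  body : ∀ {E} (x : Fin n) → Progress (toℕ x) E →
         Σ[ E′ ∈ Vec ℤ n ] (Progress (suc (toℕ x)) E′ ×
           (∀ {t s} → Run program 1 (config 4 (+ toℕ x ∷ []) E′) t s →
            Σ[ t′ ∈ ℕ ] (t′ ≤ 3 ℕ.+ t × Run program 1 (config 0 (+ toℕ x ∷ []) E) t′ s)))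
  body {E} x inv with Fin.any? (λ i → x Fin.≟ c i)
  ... | yes (i , x≡c) = _ , inv′ , λ {t} run → 2 ℕ.+ t , ℕ.n≤1+n _ ,
        next (fits inv x≤n) (test-marked x E entry) (next (fits inv x≤n) (negate x E entry) run)
    where
    x≤n : toℕ x ≤ n
    x≤n = ℕ.<⇒≤ (Fin.toℕ<n x)

    entry : lookup E x ≡ -[1+ toℕ (a i) ]
    entry = trans (pending inv x ℕ.≤-refl) (trans (cong (lookup D) x≡c) (marked i))

    inv′ : Progress (suc (toℕ x)) (E [ x ]≔ + ⟦ a i ⟧)
    inv′ = advance x
      (cong (λ y → + ⟦ y ⟧) (sym (trans (cong (λ y → value ⟦ y ⟧) x≡c) (value-marked i)))) inv
  ... | no x∉c = _ , inv′ , λ {t} run → 3 ℕ.+ t , ℕ.≤-refl ,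
        next (fits inv x≤n) (test-unmarked x E entry)
          (next (fits inv x≤n) (copy x y E y-left) (next (fits inv′ x≤n) refl run))
    where
    x≤n : toℕ x ≤ n
    x≤n = ℕ.<⇒≤ (Fin.toℕ<n x)

    x≢c : ∀ i → x ≢ c i
    x≢c i x≡c = x∉c (i , x≡c)

    neighbour : Σ[ y ∈ Fin n ] ⟦ y ⟧ ≡ toℕ x
    neighbour = left-neighbour x (x≢c zero ∘ c₁-zero x)

    y : Fin n
    y = proj₁ neighbour

    y-left : ⟦ y ⟧ ≡ toℕ x
    y-left = proj₂ neighbour

    entry : lookup E x ≡ + ⟦ π⁻ x ⟧
    entry = trans (pending inv x ℕ.≤-refl) (unmarked-⟦⟧ x x≢c)

    inv′ : Progress (suc (toℕ x)) (E [ x ]≔ lookup E y)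
    inv′ = advance x (trans (decoded inv y (ℕ.≤-reflexive y-left))
      (cong (λ z → + ⟦ z ⟧) (trans (cong value y-left) (sym (value-unmarked x x≢c))))) inv

  -- One round of the loop, up to the test that ends it; as for body, the steps
  -- are prepended to a given run.
  round : ∀ {j E} → j < n → Progress j E →
          Σ[ E′ ∈ Vec ℤ n ] (Progress (suc j) E′ ×
            (∀ {t s} → Run program 1 (config 5 (+ suc j ∷ []) E′) t s →
             Σ[ t′ ∈ ℕ ] (t′ ≤ 4 ℕ.+ t × Run program 1 (config 0 (+ j ∷ []) E) t′ s)))
  round {j} {E} j<n inv with Fin.fromℕ< j<n | Fin.toℕ-fromℕ< j<n
  ... | x | refl with body x inv
  ... | E′ , inv′ , decode = E′ , inv′ , λ {t} run →
    let (t′ , t′≤ , run′) = decode (next (fits inv′ (ℕ.<⇒≤ j<n)) (increment j E′) run)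
    in t′ , ℕ.≤-trans t′≤ (ℕ.≤-reflexive (ℕ.+-suc 3 t)) , run′

  -- From index j to the end, where r places come after the current one.
  sweep : ∀ r {j E} → suc (j ℕ.+ r) ≡ n → Progress j E →
          Σ[ t ∈ ℕ ] Σ[ s ∈ Config 1 n ]
            (t ≤ 5 * suc r × Run program 1 (config 0 (+ j ∷ []) E) t s × array s ≡ contents m)
  sweep r {j} eq inv with round (subst (suc j ≤_) eq (s≤s (ℕ.m≤m+n j r))) inv
  sweep zero {j} eq inv | E′ , inv′ , decode
    with trans (cong suc (sym (ℕ.+-identityʳ j))) eq
  ... | refl =
    let (t , t≤ , run) = decode (next (fits inv′ ℕ.≤-refl) (exit E′)
                                   (halted (fits inv′ ℕ.≤-refl) refl))
    in t , _ , t≤ , run , finished inv′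
  sweep (suc r) {j} eq inv | E′ , inv′ , decode =
    let eq′ = trans (cong suc (sym (ℕ.+-suc j r))) eq
        sj<n = subst (suc (suc j) ≤_) eq′ (s≤s (s≤s (ℕ.m≤m+n j r)))
        (t , s , t≤ , run , final) = sweep r eq′ inv′
        (t′ , t′≤ , run′) = decode (next (fits inv′ (ℕ.<⇒≤ sj<n)) (continue E′ sj<n) run)
    in t′ , s
     , ℕ.≤-trans t′≤ (ℕ.≤-trans (ℕ.+-monoʳ-≤ 5 t≤) (ℕ.≤-reflexive (sym (ℕ.*-suc 5 (suc r)))))
     , run′ , final

theorem3p10 : Σ[ P ∈ Program 1 ] Σ[ T ∈ ℕ ] Σ[ S ∈ ℕ ]
    (∀ (n : ℕ) (p : IP n) (D : Vec ℤ n) → ImplicitInverse (proj₂ p) D →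
    Σ[ t ∈ ℕ ] Σ[ s ∈ Config 1 n ] Σ[ m ∈ M n ]
    (t ≤ T * n ×
    Run P S (initial D) t s ×
    Associated (proj₂ p) m ×
    array s ≡ contents m))
theorem3p10 = program , 5 , 1 , λ where
  -- Since 1 ≤ k ≤ n, neither n nor k is 0.
  zero (zero , p) D D-inverse → contradiction (IdempotentPermutation.1≤k p) λ ()
  zero (suc k , p) D D-inverse → contradiction (IdempotentPermutation.k≤n p) λ ()
  (suc n) (zero , p) D D-inverse → contradiction (IdempotentPermutation.1≤k p) λ ()
  (suc n) (suc k , p) D D-inverse →
    let open Multiset p
        open Sweep p D D-inverse
        (t , s , t≤ , run , final) = sweep n refl start
    in t , s , m , t≤ , run , m-associated , final
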